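{- Let $k$ be any positive integer, let $Q_8$ be the quaternion group of order $8$ and $C_2^k$ the elementary abelian group of order $2^k$. Then $\alpha(Q_8\times C_2^k)=16+2k$.
   Context: All graphs are finite and simple. For a finite group $G$, $\alpha(G)$ denotes the minimum number of vertices of a graph $\Gamma$ whose full automorphism group $\mathrm{Aut}\,\Gamma$ is isomorphic to $G$. -}

module Defs where

open import Data.Nat using (ℕ; suc; _+_; _*_; _≤_)
open import Data.Bool using (Bool; true; false; _xor_)
open import Data.Fin using (Fin)
open import Data.Fin.Permutation using (Permutation′; _⟨$⟩ʳ_)
open import Data.Vec using (Vec; zipWith)
open import Data.Product using (_×_; _,_; Σ)
open import Relation.Binary.PropositionalEquality using (_≡_)

record Graph (n : ℕ) : Set where
  field
    adj    : Fin n → Fin n → Bool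
    sym    : ∀ i j → adj i j ≡ adj j i
    irrefl : ∀ i → adj i i ≡ false
open Graph public

record Automorphism {n : ℕ} (Γ : Graph n) : Set where
  field
    perm     : Permutation′ n
    preserve : ∀ i j → adj Γ (perm ⟨$⟩ʳ i) (perm ⟨$⟩ʳ j) ≡ adj Γ i j
open Automorphism public

app : ∀ {n} {Γ : Graph n} → Automorphism Γ → Fin n → Fin n
app σ x = perm σ ⟨$⟩ʳ x

data QU : Set where
  𝟙 𝕚 𝕛 𝕜 : QU

-- product of units: (sign, unit), sign true means negative
unitMul : QU → QU → Bool × QU
unitMul 𝟙 b = false , b
unitMul a 𝟙 = false , a
unitMul 𝕚 𝕚 = true , 𝟙
unitMul 𝕚 𝕛 = false , 𝕜
unitMul 𝕚 𝕜 = true , 𝕛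
unitMul 𝕛 𝕚 = true , 𝕜
unitMul 𝕛 𝕛 = true , 𝟙
unitMul 𝕛 𝕜 = false , 𝕚
unitMul 𝕜 𝕚 = false , 𝕛
unitMul 𝕜 𝕛 = true , 𝕚
unitMul 𝕜 𝕜 = true , 𝟙

Q8 : Set
Q8 = Bool × QU

_·Q_ : Q8 → Q8 → Q8
(s , a) ·Q (t , b) with unitMul a b
... | u , c = ((s xor t) xor u) , c

C2^ : ℕ → Set
C2^ k = Vec Bool k

Q8×C2^ : ℕ → Set
Q8×C2^ k = Q8 × C2^ k

mulG : ∀ {k} → Q8×C2^ k → Q8×C2^ k → Q8×C2^ k
mulG (q , v) (r , w) = (q ·Q r) , zipWith _xor_ v w

record AutIsoQ8C2 {n : ℕ} (Γ : Graph n) (k : ℕ) : Set where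
  field
    φ    : Q8×C2^ k → Automorphism Γ
    hom  : ∀ a b x → app (φ (mulG a b)) x ≡ app (φ a) (app (φ b) x)
    inj  : ∀ a b → (∀ x → app (φ a) x ≡ app (φ b) x) → a ≡ b
    surj : ∀ (σ : Automorphism Γ) → Σ (Q8×C2^ k) λ a → ∀ x → app (φ a) x ≡ app σ x

αQ8C2≡ : ℕ → ℕ → Set
αQ8C2≡ k m =
  Σ (Graph m) (λ Γ → AutIsoQ8C2 Γ k) ×
  (∀ n (Γ : Graph n) → AutIsoQ8C2 Γ k → m ≤ n)

{-# OPTIONS --safe #-}
module Submission where

-- Lower bound.  Let z = -1 ∈ Q₈ and let Z ≅ C₂ᵏ⁺¹ be the centre of G = Q₈ × C₂ᵏ.  If z moves x, then the
-- stabiliser of x lies in Z, because every element outside Z squares to z.  The map that acts as z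
-- on (G ∖ A)x, where A = ⟨𝕚⟩ × C₂ᵏ, and fixes all other vertices preserves adjacency inside Gx.  It fixes
-- x but is not in G, so it is no automorphism; hence some y ∉ Gx is such that no g ∈ G has gy = y
-- and gx = zx.  Let c be the codimension of H = Stab_Z(x) in Z, and d that of H ∩ Stab(y) in H.  Then
-- c ≥ 1, |Gx| ≥ 4·2ᶜ and |Gy| ≥ 8·2ᵈ, the extra factor 2 coming from z ∉ H·Stab(y).  The subgroup
-- H ∩ Stab(y), of rank k + 1 - c - d, fixes both orbits and needs two further points per dimension,
-- so n ≥ 4·2ᶜ + 8·2ᵈ + 2(k + 1 - c - d) ≥ 16 + 2k.
--
-- Upper bound.  Start from a graph on 16 vertices with automorphism group Q₈, and repeatedly take the
-- complement and add two isolated vertices; as no vertex ever dominates the graph, every step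
-- multiplies the automorphism group by the C₂ swapping the two new vertices.

open import Defs renaming (sym to adj-sym)
open import Data.Bool using (Bool; true; false; _xor_; if_then_else_; not; _∧_)
import Data.Bool.Properties as Bool
open import Data.Empty using (⊥)
open import Data.Fin using (Fin; zero; suc; _↑ʳ_; #_; combine)
open import Data.Fin.Permutation using (Permutation; permutation; flip; _⟨$⟩ʳ_; _⟨$⟩ˡ_; inverseˡ; inverseʳ)
import Data.Fin.Properties as Fin
open import Data.List using (List; []; _∷_; _++_; map; length; lookup)
open import Data.List.Membership.Propositional using (_∈_)
open import Data.List.Membership.Propositional.Properties using (∈-map⁻; ∈-lookup)
open import Data.List.Properties using (length-++; length-map)
open import Data.List.Relation.Unary.All as All using (All)
import Data.List.Relation.Unary.All.Properties as All
open import Data.List.Relation.Unary.AllPairs using ([]; _∷_)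
import Data.List.Relation.Unary.Any as Any
open import Data.List.Relation.Unary.Unique.Propositional using (Unique)
import Data.List.Relation.Unary.Unique.Propositional.Properties as Unique
open import Data.Nat using (ℕ; zero; suc; _+_; _*_; _^_; _≤_; _<_; z≤n)
open import Data.Nat.Induction using (Acc; acc; <-wellFounded)
open import Data.Nat.Properties using
  ( ≤-trans; ≤-reflexive; +-mono-≤; +-monoˡ-≤; +-monoʳ-≤; *-monoʳ-≤; m<m+n; m^n>0; n≢0⇒n>0
  ; +-suc; +-identityʳ; *-suc; suc-injective; module ≤-Reasoning )
open import Data.Nat.Tactic.RingSolver using (solve-∀)
open import Data.Product using (_×_; _,_; Σ; ∃; proj₁; proj₂; -,_)
open import Data.Sum using (_⊎_; inj₁; inj₂; [_,_]′)
open import Data.Vec using (Vec; []; _∷_; zipWith; replicate)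
import Data.Vec as Vec using (lookup)
import Data.Vec.Properties as Vec
open import Function using (_∘_; id)
open import Relation.Binary using (DecidableEquality)
open import Relation.Binary.PropositionalEquality
open import Relation.Nullary using (¬_; Dec; yes; no; does; contradiction)
open import Relation.Nullary.Decidable using
  (map′; ¬?; _×-dec_; _⊎-dec_; _→-dec_; from-yes; decidable-stable; dec-true; dec-false)
open import Relation.Unary using (Decidable)

-- Finite search, by which identities in Q₈ are settled by evaluation

Exhaustible : Set → Set₁
Exhaustible A = {P : A → Set} → Decidable P → Dec (∃ P)

exhaust-Bool : Exhaustible Bool
exhaust-Bool P? = map′
  (λ { (inj₁ p) → -, p ; (inj₂ p) → -, p })
  (λ { (false , p) → inj₁ p ; (true , p) → inj₂ p })
  (P? false ⊎-dec P? true)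

exhaust-QU : Exhaustible QU
exhaust-QU P? = map′
  (λ { (inj₁ p) → -, p ; (inj₂ (inj₁ p)) → -, p ; (inj₂ (inj₂ (inj₁ p))) → -, p ; (inj₂ (inj₂ (inj₂ p))) → -, p })
  (λ { (𝟙 , p) → inj₁ p ; (𝕚 , p) → inj₂ (inj₁ p)
     ; (𝕛 , p) → inj₂ (inj₂ (inj₁ p)) ; (𝕜 , p) → inj₂ (inj₂ (inj₂ p)) })
  (P? 𝟙 ⊎-dec P? 𝕚 ⊎-dec P? 𝕛 ⊎-dec P? 𝕜)

exhaust-× : ∀ {A B} → Exhaustible A → Exhaustible B → Exhaustible (A × B)
exhaust-× any-A any-B P? = map′
  (λ (a , b , p) → (a , b) , p)
  (λ ((a , b) , p) → a , b , p)
  (any-A λ a → any-B λ b → P? (a , b))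

exhaust-Vec : ∀ n → Exhaustible (Vec Bool n)
exhaust-Vec zero    P? = map′ (λ p → [] , p) (λ { ([] , p) → p }) (P? [])
exhaust-Vec (suc n) P? = map′
  (λ (b , v , p) → b ∷ v , p)
  (λ { (b ∷ v , p) → b , v , p })
  (exhaust-Bool λ b → exhaust-Vec n λ v → P? (b ∷ v))

exhaust-Q8 : Exhaustible Q8
exhaust-Q8 = exhaust-× exhaust-Bool exhaust-QU

∀-dec : ∀ {A} → Exhaustible A → ∀ {P : A → Set} → Decidable P → Dec (∀ a → P a)
∀-dec any-A P? = map′
  (λ none a → decidable-stable (P? a) λ ¬p → none (a , ¬p))
  (λ all (a , ¬p) → ¬p (all a))
  (¬? (any-A (¬? ∘ P?)))

index : QU → Fin 4
index 𝟙 = zero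
index 𝕚 = suc zero
index 𝕛 = suc (suc zero)
index 𝕜 = suc (suc (suc zero))

index-injective : ∀ {a b} → index a ≡ index b → a ≡ b
index-injective {𝟙} {𝟙} _ = refl
index-injective {𝕚} {𝕚} _ = refl
index-injective {𝕛} {𝕛} _ = refl
index-injective {𝕜} {𝕜} _ = refl

_≟U_ : DecidableEquality QU
a ≟U b = map′ index-injective (cong index) (index a Fin.≟ index b)

_≟Q_ : DecidableEquality Q8
(s , a) ≟Q (t , b) = map′ (λ (p , q) → cong₂ _,_ p q) (λ { refl → refl , refl })
  (s Bool.≟ t ×-dec a ≟U b)

perm-injective : ∀ {m n} (π : Permutation m n) {i j} → π ⟨$⟩ʳ i ≡ π ⟨$⟩ʳ j → i ≡ j
perm-injective π eq = trans (sym (inverseˡ π)) (trans (cong (π ⟨$⟩ˡ_) eq) (inverseˡ π))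

-- Elementary abelian 2-groups

infixl 6 _⊕_

_⊕_ : ∀ {n} → Vec Bool n → Vec Bool n → Vec Bool n
_⊕_ = zipWith _xor_

𝟎 : ∀ {n} → Vec Bool n
𝟎 = replicate _ false

⊕-comm : ∀ {n} (u v : Vec Bool n) → u ⊕ v ≡ v ⊕ u
⊕-comm = Vec.zipWith-comm Bool.xor-comm

⊕-assoc : ∀ {n} (u v w : Vec Bool n) → u ⊕ v ⊕ w ≡ u ⊕ (v ⊕ w)
⊕-assoc = Vec.zipWith-assoc Bool.xor-assoc

⊕-identityˡ : ∀ {n} (v : Vec Bool n) → 𝟎 ⊕ v ≡ v
⊕-identityˡ = Vec.zipWith-identityˡ Bool.xor-identityˡ

⊕-self : ∀ {n} (v : Vec Bool n) → v ⊕ v ≡ 𝟎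
⊕-self []      = refl
⊕-self (b ∷ v) = cong₂ _∷_ (Bool.xor-same b) (⊕-self v)

⊕-cancel : ∀ {n} (u v : Vec Bool n) → u ⊕ (u ⊕ v) ≡ v
⊕-cancel u v = begin
  u ⊕ (u ⊕ v) ≡⟨ ⊕-assoc u u v ⟨
  u ⊕ u ⊕ v   ≡⟨ cong (_⊕ v) (⊕-self u) ⟩
  𝟎 ⊕ v       ≡⟨ ⊕-identityˡ v ⟩
  v           ∎
  where open ≡-Reasoning

⊕-interchange : ∀ {n} (s t u v : Vec Bool n) → (s ⊕ t) ⊕ (u ⊕ v) ≡ (s ⊕ u) ⊕ (t ⊕ v)
⊕-interchange []      []      []      []      = refl
⊕-interchange (a ∷ s) (b ∷ t) (c ∷ u) (d ∷ v) = cong₂ _∷_ (swap a b c d) (⊕-interchange s t u v)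
  where
  swap : ∀ a b c d → (a xor b) xor (c xor d) ≡ (a xor c) xor (b xor d)
  swap = from-yes (∀-dec exhaust-Bool λ a → ∀-dec exhaust-Bool λ b → ∀-dec exhaust-Bool λ c →
    ∀-dec exhaust-Bool λ d → ((a xor b) xor (c xor d)) Bool.≟ ((a xor c) xor (b xor d)))

record LinearEmbedding (m n : ℕ) : Set where
  field
    to         : Vec Bool m → Vec Bool n
    to-⊕       : ∀ u v → to (u ⊕ v) ≡ to u ⊕ to v
    to-kernel  : ∀ v → to v ≡ 𝟎 → v ≡ 𝟎

  to-𝟎 : to 𝟎 ≡ 𝟎
  to-𝟎 = begin
    to 𝟎        ≡⟨ cong to (⊕-self 𝟎) ⟨
    to (𝟎 ⊕ 𝟎)  ≡⟨ to-⊕ 𝟎 𝟎 ⟩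
    to 𝟎 ⊕ to 𝟎 ≡⟨ ⊕-self (to 𝟎) ⟩
    𝟎           ∎
    where open ≡-Reasoning

open LinearEmbedding

id-embedding : ∀ {n} → LinearEmbedding n n
id-embedding = record { to = id ; to-⊕ = λ _ _ → refl ; to-kernel = λ _ → id }

infixr 9 _∘L_

_∘L_ : ∀ {l m n} → LinearEmbedding m n → LinearEmbedding l m → LinearEmbedding l n
f ∘L g = record
  { to        = to f ∘ to g
  ; to-⊕      = λ u v → trans (cong (to f) (to-⊕ g u v)) (to-⊕ f _ _)
  ; to-kernel = λ v → to-kernel g v ∘ to-kernel f (to g v)
  }

IsSubgroup : ∀ {n} → (Vec Bool n → Set) → Set
IsSubgroup P = P 𝟎 × (∀ {u v} → P u → P v → P (u ⊕ v))

-- For a subgroup `P`, `basis` parametrises it and `coset` picks `2 ^ codim` representatives of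
-- distinct cosets. Sums are also differences here, hence the form of `coset-sep`.
record Splitting {n} (P : Vec Bool n → Set) : Set where
  field
    dim codim : ℕ
    dim+codim : dim + codim ≡ n
    basis     : LinearEmbedding dim n
    basis∈    : ∀ v → P (to basis v)
    coset     : Vec Bool codim → Vec Bool n
    coset-sep : ∀ {u v} → P (coset u ⊕ coset v) → u ≡ v
    full      : codim ≡ 0 → ∀ v → P v

abstract
  -- Gaussian elimination on the leading coordinate: a vector `true ∷ t` in `P` is a new basis
  -- vector; if there is none, the leading bit itself tells cosets apart.
  splitting : ∀ n (P : Vec Bool n → Set) → Decidable P → IsSubgroup P → Splitting P
  splitting zero P P? (P-𝟎 , _) = record
    { dim = 0 ; codim = 0 ; dim+codim = refl
    ; basis = id-embedding ; basis∈ = λ { [] → P-𝟎 }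
    ; coset = id ; coset-sep = λ { {[]} {[]} _ → refl }
    ; full = λ { _ [] → P-𝟎 }
    }
  splitting (suc n) P P? (P-𝟎 , P-⊕)
    with splitting n (P ∘ (false ∷_)) (P? ∘ (false ∷_)) (P-𝟎 , P-⊕)
       | exhaust-Vec n (P? ∘ (true ∷_))
  ... | S | yes (t , Pt) = record
    { dim = suc dim ; codim = codim ; dim+codim = cong suc dim+codim
    ; basis = record { to = lift ; to-⊕ = lift-⊕ ; to-kernel = lift-kernel }
    ; basis∈ = λ { (false ∷ v) → basis∈ v ; (true ∷ v) → P-⊕ Pt (basis∈ v) }
    ; coset = (false ∷_) ∘ coset ; coset-sep = coset-sep
    ; full = λ { c≡0 (false ∷ v) → full c≡0 v
               -- `true ∷ v` is the sum of `true ∷ t` and `false ∷ (t ⊕ v)`.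
               ; c≡0 (true ∷ v) → subst (P ∘ (true ∷_)) (⊕-cancel t v) (P-⊕ Pt (full c≡0 (t ⊕ v))) }
    }
    where
    open Splitting S
    lift : Vec Bool (suc dim) → Vec Bool (suc n)
    lift (false ∷ v) = false ∷ to basis v
    lift (true ∷ v)  = true ∷ t ⊕ to basis v
    lift-⊕ : ∀ u v → lift (u ⊕ v) ≡ lift u ⊕ lift v
    lift-⊕ (false ∷ u) (false ∷ v) = cong (false ∷_) (to-⊕ basis u v)
    lift-⊕ (false ∷ u) (true ∷ v) = cong (true ∷_) (begin
      t ⊕ to basis (u ⊕ v)          ≡⟨ cong (t ⊕_) (to-⊕ basis u v) ⟩
      t ⊕ (to basis u ⊕ to basis v) ≡⟨ cong (_⊕ (to basis u ⊕ to basis v)) (⊕-identityˡ t) ⟨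
      𝟎 ⊕ t ⊕ (to basis u ⊕ to basis v) ≡⟨ ⊕-interchange 𝟎 t _ _ ⟩
      (𝟎 ⊕ to basis u) ⊕ (t ⊕ to basis v) ≡⟨ cong (_⊕ (t ⊕ to basis v)) (⊕-identityˡ _) ⟩
      to basis u ⊕ (t ⊕ to basis v) ∎)
      where open ≡-Reasoning
    lift-⊕ (true ∷ u) (false ∷ v) = cong (true ∷_) (begin
      t ⊕ to basis (u ⊕ v)          ≡⟨ cong (t ⊕_) (to-⊕ basis u v) ⟩
      t ⊕ (to basis u ⊕ to basis v) ≡⟨ ⊕-assoc t _ _ ⟨
      t ⊕ to basis u ⊕ to basis v   ∎)
      where open ≡-Reasoning
    lift-⊕ (true ∷ u) (true ∷ v) = cong (false ∷_) (begin
      to basis (u ⊕ v)              ≡⟨ to-⊕ basis u v ⟩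
      to basis u ⊕ to basis v       ≡⟨ ⊕-identityˡ _ ⟨
      𝟎 ⊕ (to basis u ⊕ to basis v) ≡⟨ cong (_⊕ (to basis u ⊕ to basis v)) (⊕-self t) ⟨
      t ⊕ t ⊕ (to basis u ⊕ to basis v) ≡⟨ ⊕-interchange t t _ _ ⟩
      (t ⊕ to basis u) ⊕ (t ⊕ to basis v) ∎)
      where open ≡-Reasoning
    lift-kernel : ∀ v → lift v ≡ 𝟎 → v ≡ 𝟎
    lift-kernel (false ∷ v) eq = cong (false ∷_) (to-kernel basis v (Vec.∷-injectiveʳ eq))
    lift-kernel (true ∷ v) ()
  ... | S | no ¬Pt = record
    { dim = dim ; codim = suc codim ; dim+codim = trans (+-suc dim codim) (cong suc dim+codim)
    ; basis = record
      { to = (false ∷_) ∘ to basis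
      ; to-⊕ = λ u v → cong (false ∷_) (to-⊕ basis u v)
      ; to-kernel = λ v → to-kernel basis v ∘ Vec.∷-injectiveʳ
      }
    ; basis∈ = basis∈
    ; coset = λ { (b ∷ v) → b ∷ coset v }
    ; coset-sep = λ
      { {false ∷ _} {false ∷ _} p → cong (false ∷_) (coset-sep p)
      ; {true ∷ _} {true ∷ _} p → cong (true ∷_) (coset-sep p)
      ; {false ∷ _} {true ∷ _} p → contradiction (-, p) ¬Pt
      ; {true ∷ _} {false ∷ _} p → contradiction (-, p) ¬Pt
      }
    ; full = λ ()
    }
    where open Splitting S

-- Counting by lists without repetition

vectors : ∀ n → List (Vec Bool n)
vectors zero    = [] ∷ []
vectors (suc n) = map (false ∷_) (vectors n) ++ map (true ∷_) (vectors n)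

length-vectors : ∀ n → length (vectors n) ≡ 2 ^ n
length-vectors zero    = refl
length-vectors (suc n) = begin
  length (vectors (suc n))                                ≡⟨ length-++ (map (false ∷_) (vectors n)) ⟩
  length (map (false ∷_) (vectors n)) + length (map (true ∷_) (vectors n))
    ≡⟨ cong₂ _+_ (length-map _ (vectors n)) (length-map _ (vectors n)) ⟩
  length (vectors n) + length (vectors n)                 ≡⟨ cong (λ m → m + m) (length-vectors n) ⟩
  2 ^ n + 2 ^ n                                           ≡⟨ cong (2 ^ n +_) (+-identityʳ (2 ^ n)) ⟨
  2 ^ suc n                                               ∎
  where open ≡-Reasoning

vectors-unique : ∀ n → Unique (vectors n)
vectors-unique zero    = All.[] ∷ []
vectors-unique (suc n) = Unique.++⁺
  (Unique.map⁺ Vec.∷-injectiveʳ (vectors-unique n))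
  (Unique.map⁺ Vec.∷-injectiveʳ (vectors-unique n))
  disjoint
  where
  disjoint : ∀ {v} → v ∈ map (false ∷_) (vectors n) × v ∈ map (true ∷_) (vectors n) → ⊥
  disjoint (p , q) with ∈-map⁻ (false ∷_) p | ∈-map⁻ (true ∷_) q
  ... | _ , _ , refl | _ , _ , ()

lookup-injective : ∀ {A : Set} {xs : List A} → Unique xs → ∀ {i j} → lookup xs i ≡ lookup xs j → i ≡ j
lookup-injective (_ ∷ _)    {zero}  {zero}  _  = refl
lookup-injective (x∉xs ∷ _) {zero}  {suc j} eq = contradiction eq (All.lookup x∉xs (∈-lookup j))
lookup-injective (x∉xs ∷ _) {suc i} {zero}  eq = contradiction (sym eq) (All.lookup x∉xs (∈-lookup i))
lookup-injective (_ ∷ xs!)  {suc _} {suc _} eq = cong suc (lookup-injective xs! eq)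

unique-length : ∀ {n} {xs : List (Fin n)} → Unique xs → length xs ≤ n
unique-length xs! = Fin.injective⇒≤ (lookup-injective xs!)

-- The group Q₈ × C₂ᵏ

Q-unit : ∀ a → (false , 𝟙) ·Q a ≡ a
Q-unit = from-yes (∀-dec exhaust-Q8 λ a → ((false , 𝟙) ·Q a) ≟Q a)

Q-assoc : ∀ a b c → (a ·Q b) ·Q c ≡ a ·Q (b ·Q c)
Q-assoc = from-yes (∀-dec exhaust-Q8 λ a → ∀-dec exhaust-Q8 λ b → ∀-dec exhaust-Q8 λ c →
  ((a ·Q b) ·Q c) ≟Q (a ·Q (b ·Q c)))

Q-inv : Q8 → Q8
Q-inv (s , 𝟙) = s , 𝟙
Q-inv (s , a) = true xor s , a

Q-inverseˡ : ∀ a → Q-inv a ·Q a ≡ (false , 𝟙)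
Q-inverseˡ = from-yes (∀-dec exhaust-Q8 λ a → (Q-inv a ·Q a) ≟Q (false , 𝟙))

Q-inverseʳ : ∀ a → a ·Q Q-inv a ≡ (false , 𝟙)
Q-inverseʳ = from-yes (∀-dec exhaust-Q8 λ a → (a ·Q Q-inv a) ≟Q (false , 𝟙))

Q-central : ∀ s a → (s , 𝟙) ·Q a ≡ a ·Q (s , 𝟙)
Q-central = from-yes (∀-dec exhaust-Bool λ s → ∀-dec exhaust-Q8 λ a → ((s , 𝟙) ·Q a) ≟Q (a ·Q (s , 𝟙)))

Q-square : ∀ a → proj₂ a ≡ 𝟙 ⊎ a ·Q a ≡ (true , 𝟙)
Q-square = from-yes (∀-dec exhaust-Q8 λ a → (proj₂ a ≟U 𝟙) ⊎-dec ((a ·Q a) ≟Q (true , 𝟙)))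

Q-sign : ∀ s a → (false , a) ·Q (s , 𝟙) ≡ (s , a)
Q-sign = from-yes (∀-dec exhaust-Bool λ s → ∀-dec exhaust-QU λ a → ((false , a) ·Q (s , 𝟙)) ≟Q (s , a))

-- Forgetting the sign is the quotient map by the centre, so the unit part names the coset.
Q-same-coset : ∀ a b → proj₂ (Q-inv a ·Q b) ≡ 𝟙 → proj₂ a ≡ proj₂ b
Q-same-coset = λ a b → [ (λ ≢𝟙 eq → contradiction eq ≢𝟙) , (λ eq _ → eq) ]′ (dec a b)
  where
  dec : ∀ a b → ¬ (proj₂ (Q-inv a ·Q b) ≡ 𝟙) ⊎ proj₂ a ≡ proj₂ b
  dec = from-yes (∀-dec exhaust-Q8 λ a → ∀-dec exhaust-Q8 λ b →
    ¬? (proj₂ (Q-inv a ·Q b) ≟U 𝟙) ⊎-dec (proj₂ a ≟U proj₂ b))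

-- The character of Q₈ with kernel ⟨𝕚⟩. Read off the first component of an element of `G`, it has
-- kernel A.
χ : Q8 → Bool
χ (_ , 𝟙) = false
χ (_ , 𝕚) = false
χ (_ , 𝕛) = true
χ (_ , 𝕜) = true

χ-hom : ∀ a b → χ (a ·Q b) ≡ χ a xor χ b
χ-hom = from-yes (∀-dec exhaust-Q8 λ a → ∀-dec exhaust-Q8 λ b → χ (a ·Q b) Bool.≟ (χ a xor χ b))

χ-inv : ∀ a → χ (Q-inv a) ≡ χ a
χ-inv = from-yes (∀-dec exhaust-Q8 λ a → χ (Q-inv a) Bool.≟ χ a)

-- Elements outside ⟨𝕚⟩ square to -1, so inverting them is multiplying by -1.
χ-inverse : ∀ a → χ a ≡ true → Q-inv a ≡ (true , 𝟙) ·Q a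
χ-inverse (s , 𝕛) _ = cong (_, 𝕛) (sym (Bool.xor-identityʳ _))
χ-inverse (s , 𝕜) _ = cong (_, 𝕜) (sym (Bool.xor-identityʳ _))

module Group (k : ℕ) where

  infixl 7 _∙_

  G : Set
  G = Q8×C2^ k

  _∙_ : G → G → G
  _∙_ = mulG

  ε z : G
  ε = (false , 𝟙) , 𝟎
  z = (true , 𝟙) , 𝟎

  inv : G → G
  inv (a , v) = Q-inv a , v

  -- The centre of `G` in coordinates, led by the sign bit; thus `z` is `ζ (true ∷ 𝟎)`.
  ζ : Vec Bool (suc k) → G
  ζ (s ∷ v) = (s , 𝟙) , v

  unit : QU → G
  unit u = (false , u) , 𝟎

  identityˡ : ∀ g → ε ∙ g ≡ g
  identityˡ (a , v) = cong₂ _,_ (Q-unit a) (⊕-identityˡ v)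

  inverseˡ′ : ∀ g → inv g ∙ g ≡ ε
  inverseˡ′ (a , v) = cong₂ _,_ (Q-inverseˡ a) (⊕-self v)

  inverseʳ′ : ∀ g → g ∙ inv g ≡ ε
  inverseʳ′ (a , v) = cong₂ _,_ (Q-inverseʳ a) (⊕-self v)

  ζ-hom : ∀ u v → ζ (u ⊕ v) ≡ ζ u ∙ ζ v
  ζ-hom (s ∷ u) (t ∷ v) = cong (_, u ⊕ v) (cong (_, 𝟙) (sym (Bool.xor-identityʳ _)))

  ζ-central : ∀ c g → ζ c ∙ g ≡ g ∙ ζ c
  ζ-central (s ∷ u) (a , v) = cong₂ _,_ (Q-central s a) (⊕-comm u v)

  ζ-kernel : ∀ c → ζ c ≡ ε → c ≡ 𝟎
  ζ-kernel (s ∷ u) refl = refl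

  square : ∀ g → (∃ λ c → g ≡ ζ c) ⊎ g ∙ g ≡ z
  square ((s , u) , v) with Q-square (s , u)
  ... | inj₁ refl = inj₁ (s ∷ v , refl)
  ... | inj₂ eq   = inj₂ (cong₂ _,_ eq (⊕-self v))

  inv-χ : ∀ g → χ (proj₁ g) ≡ true → inv g ≡ z ∙ g
  inv-χ (a , v) p = cong₂ _,_ (χ-inverse a p) (sym (⊕-identityˡ v))

-- The action on vertices, and an impossible extra automorphism

module Action {n k : ℕ} {Γ : Graph n} (iso : AutIsoQ8C2 Γ k) where

  open AutIsoQ8C2 iso
  open Group k
  open ≡-Reasoning

  infixr 8 _•_

  _•_ : G → Fin n → Fin n
  g • x = app (φ g) x

  •-injective : ∀ g {x y} → g • x ≡ g • y → x ≡ y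
  •-injective g = perm-injective (perm (φ g))

  adj-• : ∀ g x y → adj Γ (g • x) (g • y) ≡ adj Γ x y
  adj-• g = preserve (φ g)

  -- `hom` speaks of products only; idempotence of `ε` and injectivity make it act trivially.
  •-ε : ∀ x → ε • x ≡ x
  •-ε x = •-injective ε (begin
    ε • ε • x   ≡⟨ hom ε ε x ⟨
    (ε ∙ ε) • x ≡⟨ cong (_• x) (identityˡ ε) ⟩
    ε • x       ∎)

  •-inverseˡ : ∀ g x → inv g • g • x ≡ x
  •-inverseˡ g x = begin
    inv g • g • x   ≡⟨ hom (inv g) g x ⟨
    (inv g ∙ g) • x ≡⟨ cong (_• x) (inverseˡ′ g) ⟩
    ε • x           ≡⟨ •-ε x ⟩
    x               ∎

  •-inverseʳ : ∀ g x → g • inv g • x ≡ x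
  •-inverseʳ g x = begin
    g • inv g • x   ≡⟨ hom g (inv g) x ⟨
    (g ∙ inv g) • x ≡⟨ cong (_• x) (inverseʳ′ g) ⟩
    ε • x           ≡⟨ •-ε x ⟩
    x               ∎

  ζ-comm : ∀ c g x → ζ c • g • x ≡ g • ζ c • x
  ζ-comm c g x = begin
    ζ c • g • x   ≡⟨ hom (ζ c) g x ⟨
    (ζ c ∙ g) • x ≡⟨ cong (_• x) (ζ-central c g) ⟩
    (g ∙ ζ c) • x ≡⟨ hom g (ζ c) x ⟩
    g • ζ c • x   ∎

  z-comm : ∀ g x → z • g • x ≡ g • z • x
  z-comm = ζ-comm (true ∷ 𝟎)

  ζ-⊕ : ∀ u v x → ζ (u ⊕ v) • x ≡ ζ u • ζ v • x
  ζ-⊕ u v x = trans (cong (_• x) (ζ-hom u v)) (hom (ζ u) (ζ v) x)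

  ζ-𝟎 : ∀ x → ζ 𝟎 • x ≡ x
  ζ-𝟎 = •-ε

  ζ-involutive : ∀ c x → ζ c • ζ c • x ≡ x
  ζ-involutive c x = begin
    ζ c • ζ c • x ≡⟨ ζ-⊕ c c x ⟨
    ζ (c ⊕ c) • x ≡⟨ cong (λ v → ζ v • x) (⊕-self c) ⟩
    ε • x         ≡⟨ •-ε x ⟩
    x             ∎

  ζ-faithful : ∀ c → (∀ x → ζ c • x ≡ x) → c ≡ 𝟎
  ζ-faithful c fix = ζ-kernel c (inj _ _ λ x → trans (fix x) (sym (•-ε x)))

  exhaust-G : Exhaustible G
  exhaust-G = exhaust-× exhaust-Q8 (exhaust-Vec k)

  -- Every element outside the centre squares to z.
  stabiliser-central : ∀ {x} → z • x ≢ x → ∀ g → g • x ≡ x → ∃ λ c → g ≡ ζ c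
  stabiliser-central {x} zx≢x g gx≡x with square g
  ... | inj₁ central = central
  ... | inj₂ g²≡z = contradiction
    (begin
      z • x       ≡⟨ cong (_• x) g²≡z ⟨
      (g ∙ g) • x ≡⟨ hom g g x ⟩
      g • g • x   ≡⟨ cong (g •_) gx≡x ⟩
      g • x       ≡⟨ gx≡x ⟩
      x           ∎)
    zx≢x

  InOrbit : Fin n → Fin n → Set
  InOrbit x y = ∃ λ g → g • x ≡ y

  -- Central elements commute with the action, so central stabilisers are constant along an orbit.
  ζ-InOrbit : ∀ c {x y} → InOrbit x y → ζ c • x ≡ x → ζ c • y ≡ y
  ζ-InOrbit c {x} (g , refl) fix = trans (ζ-comm c g x) (cong (g •_) fix)

  ζ-InOrbit⁻ : ∀ c {x y} → InOrbit x y → ζ c • y ≡ y → ζ c • x ≡ x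
  ζ-InOrbit⁻ c {x} (g , refl) fix = •-injective g (trans (sym (ζ-comm c g x)) fix)

  InOrbit-trans : ∀ {x y w} → InOrbit x w → InOrbit y w → InOrbit x y
  InOrbit-trans {x} {y} {w} (g , gx≡w) (h , hy≡w) = inv h ∙ g , (begin
    (inv h ∙ g) • x ≡⟨ hom (inv h) g x ⟩
    inv h • g • x   ≡⟨ cong (inv h •_) (trans gx≡w (sym hy≡w)) ⟩
    inv h • h • y   ≡⟨ •-inverseˡ h y ⟩
    y               ∎)

  -- Applying `g` shows that a linked `y` is adjacent to both `x` and `z • x` or to neither.
  Linked : Fin n → Fin n → Set
  Linked x y = ∃ λ g → g • y ≡ y × g • x ≡ z • x

  -- By contradiction: if every vertex lies in the orbit of `x` or is linked to `x`, then `τ` is an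
  -- automorphism that no element of `G` induces.
  module Unlinked {x : Fin n} (zx≢x : z • x ≢ x)
                  (linked : ∀ y → InOrbit x y ⊎ Linked x y) where

    -- The part of the orbit reached from outside A. It is disjoint from Ax because the stabiliser
    -- of `x` is central, hence inside A.
    Outer : Fin n → Set
    Outer y = ∃ λ g → χ (proj₁ g) ≡ true × g • x ≡ y

    abstract
      outer? : Decidable Outer
      outer? y = exhaust-G λ g → (χ (proj₁ g) Bool.≟ true) ×-dec (g • x Fin.≟ y)

    τ : Fin n → Fin n
    τ y = if does (outer? y) then z • y else y

    τ-outer : ∀ {y} → Outer y → τ y ≡ z • y
    τ-outer {y} p with outer? y
    ... | yes _ = refl
    ... | no ¬p = contradiction p ¬p

    τ-inner : ∀ {y} → ¬ Outer y → τ y ≡ y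
    τ-inner {y} ¬p with outer? y
    ... | yes p = contradiction p ¬p
    ... | no _  = refl

    z-outer : ∀ {y} → Outer y → Outer (z • y)
    z-outer (g , χg , refl) = z ∙ g , trans (χ-hom (true , 𝟙) (proj₁ g)) χg , hom z g x

    τ-involutive : ∀ y → τ (τ y) ≡ y
    τ-involutive y with outer? y
    ... | yes p = trans (τ-outer (z-outer p)) (ζ-involutive (true ∷ 𝟎) y)
    ... | no ¬p = τ-inner ¬p

    -- In the Cayley graph on the orbit of x, connection elements outside ⟨𝕚⟩ × C₂ᵏ are
    -- accompanied by their inverses, that is, by their multiples by z.
    adj-z : ∀ c → χ (proj₁ c) ≡ true → adj Γ (z • c • x) x ≡ adj Γ (c • x) x
    adj-z c χc = begin
      adj Γ (z • c • x) x             ≡⟨ cong (λ y → adj Γ y x) (hom z c x) ⟨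
      adj Γ ((z ∙ c) • x) x           ≡⟨ cong (λ g → adj Γ (g • x) x) (inv-χ c χc) ⟨
      adj Γ (inv c • x) x             ≡⟨ adj-• c _ _ ⟨
      adj Γ (c • inv c • x) (c • x)   ≡⟨ cong (λ y → adj Γ y (c • x)) (•-inverseʳ c x) ⟩
      adj Γ x (c • x)                 ≡⟨ adj-sym Γ x (c • x) ⟩
      adj Γ (c • x) x                 ∎

    adj-shift : ∀ a y → adj Γ y (a • x) ≡ adj Γ (inv a • y) x
    adj-shift a y = begin
      adj Γ y (a • x)                     ≡⟨ adj-• (inv a) _ _ ⟨
      adj Γ (inv a • y) (inv a • a • x)   ≡⟨ cong (adj Γ (inv a • y)) (•-inverseˡ a x) ⟩
      adj Γ (inv a • y) x                 ∎

    -- In the orbit, an outer and an inner vertex differ by an element outside A, so `adj-z`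
    -- applies; otherwise linkedness does. The dichotomy is used at `inv b • w` because it concerns
    -- `x`, not `b • x`.
    adj-mixed : ∀ {y w} → Outer y → ¬ Outer w → adj Γ (z • y) w ≡ adj Γ y w
    adj-mixed {w = w} (b , χb , refl) ¬outer = by-cases (linked (inv b • w))
      where
      inside : ∀ a → a • x ≡ w → adj Γ (z • b • x) w ≡ adj Γ (b • x) w
      inside a refl = begin
        adj Γ (z • b • x) (a • x)     ≡⟨ adj-shift a _ ⟩
        adj Γ (inv a • z • b • x) x   ≡⟨ cong (λ y → adj Γ y x) (z-comm (inv a) (b • x)) ⟨
        adj Γ (z • inv a • b • x) x   ≡⟨ cong (λ y → adj Γ (z • y) x) (hom (inv a) b x) ⟨
        adj Γ (z • (inv a ∙ b) • x) x ≡⟨ adj-z (inv a ∙ b) χ-inv-a∙b ⟩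
        adj Γ ((inv a ∙ b) • x) x     ≡⟨ cong (λ y → adj Γ y x) (hom (inv a) b x) ⟩
        adj Γ (inv a • b • x) x       ≡⟨ adj-shift a _ ⟨
        adj Γ (b • x) (a • x)         ∎
        where
        -- An `a` outside A would place `w` in `Outer`.
        χa : χ (proj₁ a) ≡ false
        χa = Bool.¬-not λ χa → ¬outer (a , χa , refl)
        χ-inv-a∙b : χ (proj₁ (inv a ∙ b)) ≡ true
        χ-inv-a∙b = begin
          χ (proj₁ (inv a ∙ b))                 ≡⟨ χ-hom (Q-inv (proj₁ a)) (proj₁ b) ⟩
          χ (Q-inv (proj₁ a)) xor χ (proj₁ b)   ≡⟨ cong₂ _xor_ (trans (χ-inv (proj₁ a)) χa) χb ⟩
          true                                  ∎

      by-cases : InOrbit x (inv b • w) ⊎ Linked x (inv b • w) → adj Γ (z • b • x) w ≡ adj Γ (b • x) w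
      by-cases (inj₁ (g , gx≡)) = inside (b ∙ g) (begin
        (b ∙ g) • x   ≡⟨ hom b g x ⟩
        b • g • x     ≡⟨ cong (b •_) gx≡ ⟩
        b • inv b • w ≡⟨ •-inverseʳ b w ⟩
        w             ∎)
      by-cases (inj₂ (g , g-fix , gx≡zx)) = begin
        adj Γ (z • b • x) w                 ≡⟨ cong₂ (adj Γ) (z-comm b x) (sym (•-inverseʳ b w)) ⟩
        adj Γ (b • z • x) (b • inv b • w)   ≡⟨ adj-• b _ _ ⟩
        adj Γ (z • x) (inv b • w)           ≡⟨ cong₂ (adj Γ) gx≡zx g-fix ⟨
        adj Γ (g • x) (g • inv b • w)       ≡⟨ adj-• g _ _ ⟩
        adj Γ x (inv b • w)                 ≡⟨ adj-• b _ _ ⟨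
        adj Γ (b • x) (b • inv b • w)       ≡⟨ cong (adj Γ (b • x)) (•-inverseʳ b w) ⟩
        adj Γ (b • x) w                     ∎

    τ-preserve : ∀ y w → adj Γ (τ y) (τ w) ≡ adj Γ y w
    τ-preserve y w with outer? y | outer? w
    ... | yes _ | yes _ = adj-• z y w
    ... | yes p | no ¬q = adj-mixed p ¬q
    ... | no ¬p | yes q = trans (adj-sym Γ y (z • w)) (trans (adj-mixed q ¬p) (adj-sym Γ w y))
    ... | no _  | no _  = refl

    τ-automorphism : Automorphism Γ
    τ-automorphism = record
      { perm     = permutation τ τ τ-involutive τ-involutive
      ; preserve = τ-preserve
      }

    x-inner : ¬ Outer x
    x-inner (g , χg , gx≡x) with stabiliser-central zx≢x g gx≡x
    x-inner (_ , () , _) | _ ∷ _ , refl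

    impossible : ⊥
    impossible with surj τ-automorphism
    ... | g , g≗τ with stabiliser-central zx≢x g (trans (g≗τ x) (τ-inner x-inner))
    -- Being central and fixing `x`, `ζ c` fixes the whole orbit, whereas `τ` acts as `z` on the
    -- outer vertex `unit 𝕛 • x`.
    ... | c , refl = zx≢x (•-injective (unit 𝕛) (begin
      unit 𝕛 • z • x   ≡⟨ z-comm (unit 𝕛) x ⟨
      z • unit 𝕛 • x   ≡⟨ τ-outer (unit 𝕛 , refl , refl) ⟨
      τ (unit 𝕛 • x)   ≡⟨ g≗τ (unit 𝕛 • x) ⟨
      ζ c • unit 𝕛 • x ≡⟨ ζ-comm c (unit 𝕛) x ⟩
      unit 𝕛 • ζ c • x ≡⟨ cong (unit 𝕛 •_) (trans (g≗τ x) (τ-inner x-inner)) ⟩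
      unit 𝕛 • x       ∎))

-- The lower bound

2*n≤2^n : ∀ n → 2 * n ≤ 2 ^ n
2*n≤2^n zero          = z≤n
2*n≤2^n (suc zero)    = ≤-reflexive refl
2*n≤2^n (suc (suc n)) = begin
  2 * suc (suc n)             ≡⟨ *-suc 2 (suc n) ⟩
  2 + 2 * suc n               ≤⟨ +-mono-≤ (*-monoʳ-≤ 2 (m^n>0 2 n)) (2*n≤2^n (suc n)) ⟩
  2 ^ suc n + 2 ^ suc n       ≡⟨ cong (2 ^ suc n +_) (+-identityʳ (2 ^ suc n)) ⟨
  2 ^ suc (suc n)             ∎
  where open ≤-Reasoning

-- Sharp at `n = 0`. Both large orbits are measured against it, with n = c - 1 for 4·2ᶜ and n = d
-- for 8·2ᵈ; the two constants 8 make up the 16.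
2*n+8≤2^[3+n] : ∀ n → 2 * n + 8 ≤ 2 ^ (3 + n)
2*n+8≤2^[3+n] zero    = ≤-reflexive refl
2*n+8≤2^[3+n] (suc n) = begin
  2 * suc n + 8           ≡⟨ cong (_+ 8) (*-suc 2 n) ⟩
  2 + (2 * n + 8)         ≤⟨ +-mono-≤ (*-monoʳ-≤ 2 (m^n>0 2 (2 + n))) (2*n+8≤2^[3+n] n) ⟩
  2 ^ (3 + n) + 2 ^ (3 + n) ≡⟨ cong (2 ^ (3 + n) +_) (+-identityʳ (2 ^ (3 + n))) ⟨
  2 ^ (4 + n)             ∎
  where open ≤-Reasoning

module LowerBound {n k : ℕ} {Γ : Graph n} (iso : AutIsoQ8C2 Γ k) where

  open AutIsoQ8C2 iso
  open Group k
  open Action iso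

  linked? : ∀ x y → Dec (InOrbit x y ⊎ Linked x y)
  linked? x y = exhaust-G (λ g → g • x Fin.≟ y)
    ⊎-dec exhaust-G (λ g → (g • y Fin.≟ y) ×-dec (g • x Fin.≟ z • x))

  abstract
    moved : ∀ c → c ≢ 𝟎 → ∃ λ x → ζ c • x ≢ x
    moved c c≢𝟎 = Fin.¬∀⟶∃¬ n _ (λ x → ζ c • x Fin.≟ x) (c≢𝟎 ∘ ζ-faithful c)

  -- Decidability turns the refutation in `Unlinked` into an actual vertex.
  unlinked-pair : ∀ {x} → z • x ≢ x → ∃ λ y → ¬ InOrbit x y × ¬ Linked x y
  unlinked-pair {x} zx≢x with Fin.all? (linked? x)
  ... | yes linked = contradiction linked (Unlinked.impossible zx≢x)
  ... | no ¬linked with Fin.¬∀⟶∃¬ n _ (linked? x) ¬linked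
  ... | y , ¬p = y , ¬p ∘ inj₁ , ¬p ∘ inj₂

  Fixes : ∀ {r} → LinearEmbedding r (suc k) → Fin n → Set
  Fixes ι x = ∀ v → ζ (to ι v) • x ≡ x

  abstract
    -- The splitting is taken in the coordinates of `ι`, so its `basis` composes with `ι` to embed
    -- the stabiliser in the centre.
    stabiliser : ∀ {r} (ι : LinearEmbedding r (suc k)) x → Splitting (λ v → ζ (to ι v) • x ≡ x)
    stabiliser ι x = splitting _ _ (λ v → ζ (to ι v) • x Fin.≟ x)
      ( trans (cong (λ c → ζ c • x) (to-𝟎 ι)) (ζ-𝟎 x)
      , λ {u} {v} p q → trans (cong (λ c → ζ c • x) (to-⊕ ι u v))
          (trans (ζ-⊕ _ _ x) (trans (cong (ζ (to ι u) •_) q) p)) )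

  -- The values of `f` lie in distinct cosets of the central stabiliser of `x`; `f` need not be
  -- linear.
  Separated : ∀ {m} → (Vec Bool m → Vec Bool (suc k)) → Fin n → Set
  Separated f x = ∀ {u v} → ζ (f u ⊕ f v) • x ≡ x → u ≡ v

  separated-injective : ∀ {m} (f : Vec Bool m → Vec Bool (suc k)) {x} → Separated f x →
    ∀ {u v} → ζ (f u) • x ≡ ζ (f v) • x → u ≡ v
  separated-injective f {x} sep {u} {v} eq = sep (begin
    ζ (f u ⊕ f v) • x     ≡⟨ ζ-⊕ (f u) (f v) x ⟩
    ζ (f u) • ζ (f v) • x ≡⟨ cong (ζ (f u) •_) eq ⟨
    ζ (f u) • ζ (f u) • x ≡⟨ ζ-involutive (f u) x ⟩
    x                     ∎)
    where open ≡-Reasoning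

  -- Each step adjoins the orbit under W = im ι of a point that W moves, at least twice
  -- as many points as the dimension lost by passing to the stabiliser.
  extend : ∀ r → Acc _<_ r → (ι : LinearEmbedding r (suc k)) (xs : List (Fin n)) → Unique xs →
    All (Fixes ι) xs → length xs + 2 * r ≤ n
  extend zero    _         ι xs xs! fixed = ≤-trans (≤-reflexive (+-identityʳ _)) (unique-length xs!)
  extend (suc r) (acc rec) ι xs xs! fixed = begin
    length xs + 2 * suc r                       ≡⟨ cong (λ m → length xs + 2 * m) dim+codim ⟨
    length xs + 2 * (dim + codim)               ≡⟨ rearrange (length xs) dim codim ⟩
    length xs + 2 * codim + 2 * dim             ≤⟨ +-monoˡ-≤ (2 * dim) (+-monoʳ-≤ (length xs) (2*n≤2^n codim)) ⟩
    length xs + 2 ^ codim + 2 * dim             ≡⟨ cong (λ m → length xs + m + 2 * dim) length-orbit ⟨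
    length xs + length orbit + 2 * dim          ≡⟨ cong (_+ 2 * dim) (length-++ xs) ⟨
    length (xs ++ orbit) + 2 * dim              ≤⟨ extend dim (rec dim<r) (ι ∘L basis) (xs ++ orbit) unique fixed′ ⟩
    n                                           ∎
    where
    open ≤-Reasoning
    -- Any nonzero vector would do; faithfulness yields a vertex that it moves.
    e : Vec Bool (suc r)
    e = true ∷ 𝟎
    e-moves : ∃ λ x → ζ (to ι e) • x ≢ x
    e-moves = moved (to ι e) λ eq → contradiction (to-kernel ι e eq) λ ()
    x = proj₁ e-moves
    open Splitting (stabiliser ι x)
    orbit : List (Fin n)
    orbit = map (λ u → ζ (to ι (coset u)) • x) (vectors codim)
    length-orbit : length orbit ≡ 2 ^ codim
    length-orbit = trans (length-map _ (vectors codim)) (length-vectors codim)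
    rearrange : ∀ l d c → l + 2 * (d + c) ≡ l + 2 * c + 2 * d
    rearrange = solve-∀
    -- `e` lies outside the stabiliser of `x`, so the codimension is positive and the rank drops.
    dim<r : dim < suc r
    dim<r = subst (dim <_) dim+codim (m<m+n dim (n≢0⇒n>0 λ codim≡0 → proj₂ e-moves (full codim≡0 e)))
    sep : Separated (to ι ∘ coset) x
    sep {u} {v} p = coset-sep (trans (cong (λ c → ζ c • x) (to-⊕ ι (coset u) (coset v))) p)
    disjoint : ∀ {y} → y ∈ xs × y ∈ orbit → ⊥
    disjoint (y∈xs , y∈orbit) with ∈-map⁻ _ y∈orbit
    -- `ζ (to ι e)` fixes every listed vertex but, being central, moves every point of the orbit of
    -- `x`.
    ... | u , _ , refl = proj₂ e-moves (ζ-InOrbit⁻ (to ι e) (-, refl) (All.lookup fixed y∈xs e))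
    unique : Unique (xs ++ orbit)
    unique = Unique.++⁺ xs! (Unique.map⁺ (separated-injective (to ι ∘ coset) sep) (vectors-unique codim)) disjoint
    fixed′ : All (Fixes (ι ∘L basis)) (xs ++ orbit)
    fixed′ = All.++⁺ (All.map (λ fix v → fix (to basis v)) fixed)
      (All.map⁺ (All.universal (λ u v → ζ-InOrbit (to ι (to basis v)) (-, refl) (basis∈ v)) (vectors codim)))

  -- Cosets of the centre indexed by two bits, so that points of an orbit are counted by `vectors`.
  unitAt : Bool → Bool → QU
  unitAt false false = 𝟙
  unitAt false true  = 𝕚
  unitAt true  false = 𝕛
  unitAt true  true  = 𝕜

  bits : QU → Bool × Bool
  bits 𝟙 = false , false
  bits 𝕚 = false , true
  bits 𝕛 = true , false
  bits 𝕜 = true , true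

  bits-unitAt : ∀ b c → bits (unitAt b c) ≡ (b , c)
  bits-unitAt false false = refl
  bits-unitAt false true  = refl
  bits-unitAt true  false = refl
  bits-unitAt true  true  = refl

  unitAt-injective : ∀ {b c b′ c′} → unitAt b c ≡ unitAt b′ c′ → (b , c) ≡ (b′ , c′)
  unitAt-injective {b} {c} {b′} {c′} eq =
    trans (sym (bits-unitAt b c)) (trans (cong bits eq) (bits-unitAt b′ c′))

  ζ-unit : ∀ c → proj₂ (proj₁ (ζ c)) ≡ 𝟙
  ζ-unit (_ ∷ _) = refl

  same-unit : ∀ {x} → z • x ≢ x → ∀ g h → g • x ≡ h • x → proj₂ (proj₁ g) ≡ proj₂ (proj₁ h)
  same-unit {x} zx≢x g h eq = Q-same-coset (proj₁ g) (proj₁ h)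
    (trans (cong (proj₂ ∘ proj₁) (proj₂ central)) (ζ-unit (proj₁ central)))
    where
    central : ∃ λ c → inv g ∙ h ≡ ζ c
    central = stabiliser-central zx≢x (inv g ∙ h)
      (trans (hom (inv g) h x) (trans (cong (inv g •_) (sym eq)) (•-inverseˡ g x)))

  -- This yields 4·2ᵐ distinct points of the orbit of `x`: the unit tells cosets of the centre
  -- apart, and `sep` separates points within one coset.
  module Block {m} (f : Vec Bool m → Vec Bool (suc k)) {x} (zx≢x : z • x ≢ x) (sep : Separated f x) where

    element : Vec Bool (2 + m) → G
    element (b ∷ c ∷ v) = unit (unitAt b c) ∙ ζ (f v)

    element-unit : ∀ b c v → proj₂ (proj₁ (element (b ∷ c ∷ v))) ≡ unitAt b c
    element-unit b c v with f v
    ... | s ∷ _ = cong proj₂ (Q-sign s (unitAt b c))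

    points : List (Fin n)
    points = map (λ v → element v • x) (vectors (2 + m))

    length-points : length points ≡ 2 ^ (2 + m)
    length-points = trans (length-map _ (vectors (2 + m))) (length-vectors (2 + m))

    injective : ∀ {u v} → element u • x ≡ element v • x → u ≡ v
    injective {b ∷ c ∷ u} {b′ ∷ c′ ∷ v} eq
      with unitAt-injective {b} {c} {b′} {c′} (trans (sym (element-unit b c u))
             (trans (same-unit zx≢x (element (b ∷ c ∷ u)) (element (b′ ∷ c′ ∷ v)) eq) (element-unit b′ c′ v)))
    ... | refl = cong (λ w → b ∷ c ∷ w) (separated-injective f sep (•-injective (unit (unitAt b c))
      (trans (sym (hom _ (ζ (f u)) x)) (trans eq (hom _ (ζ (f v)) x)))))

    points-unique : Unique points
    points-unique = Unique.map⁺ (λ {u} {v} → injective {u} {v}) (vectors-unique (2 + m))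

    points-orbit : ∀ {y} → y ∈ points → InOrbit x y
    points-orbit y∈ with ∈-map⁻ _ y∈
    ... | v , _ , refl = element v , refl

  module Count {x y : Fin n} (zx≢x : z • x ≢ x) (y∉Gx : ¬ InOrbit x y) (unlinked : ¬ Linked x y) where

    -- This splits off H in Z, with codimension c; `S` splits off H ∩ Stab(y) in H, with codimension
    -- d.
    open Splitting (stabiliser id-embedding x)
    module S = Splitting (stabiliser basis y)
    zy≢y : z • y ≢ y
    -- If `z` fixed `y`, it would itself be a link.
    zy≢y zy≡y = unlinked (z , zy≡y , refl)
    -- The leading bit is the exponent of `z`; it doubles the set of representatives of H modulo H ∩
    -- Stab(y).
    f : Vec Bool (suc S.codim) → Vec Bool (suc k)
    f (e ∷ w) = (e ∷ 𝟎) ⊕ to basis (S.coset w)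
    f-⊕ : ∀ d u e v → f (d ∷ u) ⊕ f (e ∷ v) ≡ ((d xor e) ∷ 𝟎) ⊕ to basis (S.coset u ⊕ S.coset v)
    f-⊕ d u e v = begin
      f (d ∷ u) ⊕ f (e ∷ v)
        ≡⟨ ⊕-interchange (d ∷ 𝟎) _ (e ∷ 𝟎) _ ⟩
      ((d xor e) ∷ 𝟎 ⊕ 𝟎) ⊕ (to basis (S.coset u) ⊕ to basis (S.coset v))
        ≡⟨ cong₂ (λ o w → ((d xor e) ∷ o) ⊕ w) (⊕-self 𝟎) (sym (to-⊕ basis (S.coset u) (S.coset v))) ⟩
      ((d xor e) ∷ 𝟎) ⊕ to basis (S.coset u ⊕ S.coset v) ∎
      where open ≡-Reasoning
    -- This is z ∉ H·Stab(y): for h ∈ H, zh sends `x` to `z • x`, so fixing `y` would make it a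
    -- link.
    not-in-coset : ∀ w → ζ ((true ∷ 𝟎) ⊕ to basis w) • y ≢ y
    not-in-coset w fix = unlinked (_ , fix , trans (ζ-⊕ (true ∷ 𝟎) _ x) (cong (z •_) (basis∈ w)))
    same-coset : ∀ w → ζ (𝟎 ⊕ to basis w) • y ≡ y → ζ (to basis w) • y ≡ y
    same-coset w = trans (cong (λ c → ζ c • y) (sym (⊕-identityˡ (to basis w))))
    f-sum : ∀ d u e v → ζ (f (d ∷ u) ⊕ f (e ∷ v)) • y ≡ y →
      ζ (((d xor e) ∷ 𝟎) ⊕ to basis (S.coset u ⊕ S.coset v)) • y ≡ y
    f-sum d u e v = trans (cong (λ c → ζ c • y) (sym (f-⊕ d u e v)))
    f-sep : Separated f y
    f-sep {false ∷ u} {false ∷ v} fix = cong (false ∷_) (S.coset-sep (same-coset _ (f-sum false u false v fix)))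
    f-sep {true ∷ u}  {true ∷ v}  fix = cong (true ∷_) (S.coset-sep (same-coset _ (f-sum true u true v fix)))
    f-sep {false ∷ u} {true ∷ v}  fix = contradiction (f-sum false u true v fix) (not-in-coset _)
    f-sep {true ∷ u}  {false ∷ v} fix = contradiction (f-sum true u false v fix) (not-in-coset _)
    module X = Block coset zx≢x coset-sep
    module Y = Block f zy≢y f-sep
    disjoint : ∀ {p} → p ∈ X.points × p ∈ Y.points → ⊥
    disjoint (p∈X , p∈Y) = y∉Gx (InOrbit-trans (X.points-orbit p∈X) (Y.points-orbit p∈Y))
    fixed : All (Fixes (basis ∘L S.basis)) (X.points ++ Y.points)
    fixed = All.++⁺
      (All.tabulate λ p∈ v → ζ-InOrbit _ (X.points-orbit p∈) (basis∈ (to S.basis v)))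
      (All.tabulate λ p∈ v → ζ-InOrbit _ (Y.points-orbit p∈) (S.basis∈ v))
    count : 2 ^ (2 + codim) + 2 ^ (3 + S.codim) + 2 * S.dim ≤ n
    count = subst (λ l → l + 2 * S.dim ≤ n)
      (trans (length-++ X.points) (cong₂ _+_ X.length-points Y.length-points))
      (extend S.dim (<-wellFounded _) (basis ∘L S.basis) (X.points ++ Y.points)
        (Unique.++⁺ X.points-unique Y.points-unique disjoint) fixed)
    rearrange : ∀ b d c → 16 + 2 * (b + d + c) ≡ (2 * c + 8) + (2 * d + 8) + 2 * b
    rearrange = solve-∀
    bound-codim : ∀ c → codim ≡ c → 16 + 2 * k ≤ n
    -- Codimension 0 would put `z` in H. In the other case the variable `c` is one less than the
    -- codimension of H.
    bound-codim zero    eq = contradiction (full eq (true ∷ 𝟎)) zx≢x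
    bound-codim (suc c) eq = begin
      16 + 2 * k                                          ≡⟨ cong (λ m → 16 + 2 * m) k≡ ⟩
      16 + 2 * (S.dim + S.codim + c)                      ≡⟨ rearrange S.dim S.codim c ⟩
      (2 * c + 8) + (2 * S.codim + 8) + 2 * S.dim
        ≤⟨ +-monoˡ-≤ (2 * S.dim) (+-mono-≤ (2*n+8≤2^[3+n] c) (2*n+8≤2^[3+n] S.codim)) ⟩
      2 ^ (3 + c) + 2 ^ (3 + S.codim) + 2 * S.dim         ≡⟨ cong (λ m → 2 ^ (2 + m) + 2 ^ (3 + S.codim) + 2 * S.dim) eq ⟨
      2 ^ (2 + codim) + 2 ^ (3 + S.codim) + 2 * S.dim     ≤⟨ count ⟩
      n                                                   ∎
      where
      open ≤-Reasoning
      -- The centre has rank `suc k`; the extra one cancels against `codim ≡ suc c`.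
      k≡ : k ≡ S.dim + S.codim + c
      k≡ = suc-injective (trans (sym dim+codim) (trans (cong₂ _+_ (sym S.dim+codim) eq) (+-suc _ c)))
    bound : 16 + 2 * k ≤ n
    bound = bound-codim codim refl

  lower-bound : 16 + 2 * k ≤ n
  lower-bound =
    let x , zx≢x = moved (true ∷ 𝟎) λ ()
        y , y∉Gx , unlinked = unlinked-pair zx≢x
    in Count.bound zx≢x y∉Gx unlinked

-- Joining a graph without dominating vertices to two isolated ones

does-injective : ∀ {m n} (f : Fin m → Fin n) → (∀ {i j} → f i ≡ f j → i ≡ j) →
  ∀ i j → does (f i Fin.≟ f j) ≡ does (i Fin.≟ j)
does-injective f f-inj i j with i Fin.≟ j
... | yes refl = dec-true (f i Fin.≟ f i) refl
... | no i≢j   = dec-false (f i Fin.≟ f j) (i≢j ∘ f-inj)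

inverse : ∀ {n} {Γ : Graph n} → Automorphism Γ → Automorphism Γ
inverse {Γ = Γ} σ = record
  { perm     = flip (perm σ)
  ; preserve = λ i j → trans (sym (preserve σ _ _)) (cong₂ (adj Γ) (inverseʳ (perm σ)) (inverseʳ (perm σ)))
  }

-- Equivalently, the complement has no isolated vertex, so two added ones can be recognised.
NoDominating : ∀ {n} → Graph n → Set
NoDominating Γ = ∀ i → ∃ λ j → j ≢ i × adj Γ i j ≡ false

module Extension {n : ℕ} (Γ : Graph n) where

  co-adj : Fin n → Fin n → Bool
  co-adj i j = not (does (i Fin.≟ j)) ∧ not (adj Γ i j)

  co-adj-off : ∀ {i j} → i ≢ j → co-adj i j ≡ not (adj Γ i j)
  co-adj-off {i} {j} i≢j = cong (λ b → not b ∧ not (adj Γ i j)) (dec-false (i Fin.≟ j) i≢j)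

  co-irrefl : ∀ i → co-adj i i ≡ false
  co-irrefl i = cong (λ b → not b ∧ not (adj Γ i i)) (dec-true (i Fin.≟ i) refl)

  co-sym : ∀ i j → co-adj i j ≡ co-adj j i
  co-sym i j with i Fin.≟ j
  ... | yes refl = sym (co-irrefl i)
  ... | no i≢j   = trans (cong not (adj-sym Γ i j)) (sym (co-adj-off (i≢j ∘ sym)))

  Γ⁺-adj : Fin (2 + n) → Fin (2 + n) → Bool
  Γ⁺-adj (suc (suc i)) (suc (suc j)) = co-adj i j
  Γ⁺-adj _             _             = false

  Γ⁺-sym : ∀ i j → Γ⁺-adj i j ≡ Γ⁺-adj j i
  Γ⁺-sym zero          zero          = refl
  Γ⁺-sym zero          (suc zero)    = refl
  Γ⁺-sym zero          (suc (suc _)) = refl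
  Γ⁺-sym (suc zero)    zero          = refl
  Γ⁺-sym (suc zero)    (suc zero)    = refl
  Γ⁺-sym (suc zero)    (suc (suc _)) = refl
  Γ⁺-sym (suc (suc _)) zero          = refl
  Γ⁺-sym (suc (suc _)) (suc zero)    = refl
  Γ⁺-sym (suc (suc i)) (suc (suc j)) = co-sym i j

  Γ⁺-irrefl : ∀ i → Γ⁺-adj i i ≡ false
  Γ⁺-irrefl zero          = refl
  Γ⁺-irrefl (suc zero)    = refl
  Γ⁺-irrefl (suc (suc i)) = co-irrefl i

  Γ⁺ : Graph (2 + n)
  Γ⁺ = record { adj = Γ⁺-adj ; sym = Γ⁺-sym ; irrefl = Γ⁺-irrefl }

  Γ⁺-noDominating : NoDominating Γ⁺
  Γ⁺-noDominating zero          = suc zero , (λ ()) , refl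
  Γ⁺-noDominating (suc zero)    = zero , (λ ()) , refl
  Γ⁺-noDominating (suc (suc i)) = zero , (λ ()) , refl

  -- The bit is the new coordinate of C₂: whether the two added vertices are exchanged.
  swap^ : Bool → (Fin n → Fin n) → Fin (2 + n) → Fin (2 + n)
  swap^ b f zero          = if b then suc zero else zero
  swap^ b f (suc zero)    = if b then zero else suc zero
  swap^ b f (suc (suc i)) = suc (suc (f i))

  -- `h` is a parameter because the composition laws at hand hold only pointwise.
  swap^-∘ : ∀ b c (f g h : Fin n → Fin n) → (∀ i → h i ≡ f (g i)) →
    ∀ x → swap^ (b xor c) h x ≡ swap^ b f (swap^ c g x)
  swap^-∘ b     c     f g h eq (suc (suc i)) = cong (2 ↑ʳ_) (eq i)
  swap^-∘ false false f g h eq zero          = refl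
  swap^-∘ false false f g h eq (suc zero)    = refl
  swap^-∘ false true  f g h eq zero          = refl
  swap^-∘ false true  f g h eq (suc zero)    = refl
  swap^-∘ true  false f g h eq zero          = refl
  swap^-∘ true  false f g h eq (suc zero)    = refl
  swap^-∘ true  true  f g h eq zero          = refl
  swap^-∘ true  true  f g h eq (suc zero)    = refl

  swap^-id : ∀ x → swap^ false id x ≡ x
  swap^-id zero          = refl
  swap^-id (suc zero)    = refl
  swap^-id (suc (suc i)) = refl

  swap^-inverse : ∀ b (f g : Fin n → Fin n) → (∀ i → f (g i) ≡ i) → ∀ x → swap^ b f (swap^ b g x) ≡ x
  swap^-inverse b f g eq x = begin
    swap^ b f (swap^ b g x) ≡⟨ swap^-∘ b b f g id (sym ∘ eq) x ⟨
    swap^ (b xor b) id x    ≡⟨ cong (λ c → swap^ c id x) (Bool.xor-same b) ⟩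
    swap^ false id x        ≡⟨ swap^-id x ⟩
    x                       ∎
    where open ≡-Reasoning

  swap^-preserve : ∀ b (σ : Automorphism Γ) x y →
    Γ⁺-adj (swap^ b (app σ) x) (swap^ b (app σ) y) ≡ Γ⁺-adj x y
  swap^-preserve b     σ (suc (suc i)) (suc (suc j)) =
    cong₂ (λ p q → not p ∧ not q) (does-injective (app σ) (perm-injective (perm σ)) i j) (preserve σ i j)
  swap^-preserve false σ zero          y             = refl
  swap^-preserve false σ (suc zero)    y             = refl
  swap^-preserve true  σ zero          y             = refl
  swap^-preserve true  σ (suc zero)    y             = refl
  swap^-preserve false σ (suc (suc i)) zero          = refl
  swap^-preserve false σ (suc (suc i)) (suc zero)    = refl
  swap^-preserve true  σ (suc (suc i)) zero          = refl
  swap^-preserve true  σ (suc (suc i)) (suc zero)    = refl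

  lift : Bool → Automorphism Γ → Automorphism Γ⁺
  lift b σ = record
    { perm = permutation (swap^ b (app σ)) (swap^ b (perm σ ⟨$⟩ˡ_))
        (swap^-inverse b _ _ λ _ → inverseʳ (perm σ)) (swap^-inverse b _ _ λ _ → inverseˡ (perm σ))
    ; preserve = swap^-preserve b σ
    }

  module Restriction (noDominating : NoDominating Γ) where

    neighbour : ∀ i → ∃ λ j → co-adj i j ≡ true
    neighbour i with noDominating i
    ... | j , j≢i , eq = j , trans (co-adj-off (j≢i ∘ sym)) (cong not eq)

    -- Among the vertices of Γ⁺, exactly the two new ones are isolated.
    image : ∀ (σ : Automorphism Γ⁺) i → ∃ λ j → app σ (suc (suc i)) ≡ suc (suc j)
    image σ i with neighbour i
    ... | j , eq = core (app σ (suc (suc i))) (trans (preserve σ (suc (suc i)) (suc (suc j))) eq)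
      where
      core : ∀ x {y} → Γ⁺-adj x y ≡ true → ∃ λ j → x ≡ suc (suc j)
      core (suc (suc j)) _ = j , refl

    restrict : Automorphism Γ⁺ → Fin n → Fin n
    restrict σ i = proj₁ (image σ i)

    restrict-inverse : ∀ σ τ → (∀ x → app σ (app τ x) ≡ x) → ∀ i → restrict σ (restrict τ i) ≡ i
    restrict-inverse σ τ eq i = Fin.suc-injective (Fin.suc-injective (begin
      suc (suc (restrict σ (restrict τ i))) ≡⟨ proj₂ (image σ _) ⟨
      app σ (suc (suc (restrict τ i)))      ≡⟨ cong (app σ) (proj₂ (image τ i)) ⟨
      app σ (app τ (suc (suc i)))           ≡⟨ eq _ ⟩
      suc (suc i)                           ∎))
      where open ≡-Reasoning

    restriction : Automorphism Γ⁺ → Automorphism Γ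
    restriction σ = record { perm = π ; preserve = restrict-preserve }
      where
      π : Permutation n n
      π = permutation (restrict σ) (restrict (inverse σ))
        (restrict-inverse σ (inverse σ) λ _ → inverseʳ (perm σ))
        (restrict-inverse (inverse σ) σ λ _ → inverseˡ (perm σ))
      co-preserve : ∀ i j → co-adj (restrict σ i) (restrict σ j) ≡ co-adj i j
      co-preserve i j = trans
        (sym (cong₂ Γ⁺-adj (proj₂ (image σ i)) (proj₂ (image σ j))))
        (preserve σ (suc (suc i)) (suc (suc j)))
      restrict-preserve : ∀ i j → adj Γ (restrict σ i) (restrict σ j) ≡ adj Γ i j
      -- Off the diagonal `co-adj` determines `adj`; on it, both sides vanish by irreflexivity.
      restrict-preserve i j with i Fin.≟ j
      ... | yes refl = trans (irrefl Γ _) (sym (irrefl Γ i))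
      ... | no i≢j   = Bool.not-injective (begin
        not (adj Γ (restrict σ i) (restrict σ j)) ≡⟨ co-adj-off (i≢j ∘ perm-injective π) ⟨
        co-adj (restrict σ i) (restrict σ j)      ≡⟨ co-preserve i j ⟩
        co-adj i j                                ≡⟨ co-adj-off i≢j ⟩
        not (adj Γ i j)                           ∎)
        where open ≡-Reasoning

    Isolated : Fin (2 + n) → Set
    Isolated x = ∀ i → x ≢ suc (suc i)

    -- The inverse automorphism maps old vertices to old ones, so no new vertex can land on an old
    -- one.
    isolated-image : ∀ (σ : Automorphism Γ⁺) {x} → Isolated x → Isolated (app σ x)
    isolated-image σ {x} isolated i eq = isolated _ (begin
      x                                ≡⟨ inverseˡ (perm σ) ⟨
      app (inverse σ) (app σ x)        ≡⟨ cong (app (inverse σ)) eq ⟩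
      app (inverse σ) (suc (suc i))    ≡⟨ proj₂ (image (inverse σ) i) ⟩
      suc (suc _)                      ∎)
      where open ≡-Reasoning

    lift-restriction : ∀ σ → ∃ λ b → ∀ x → swap^ b (restrict σ) x ≡ app σ x
    lift-restriction σ = cases (app σ zero) refl (app σ (suc zero)) refl
      where
      extend : ∀ b → swap^ b (restrict σ) zero ≡ app σ zero → swap^ b (restrict σ) (suc zero) ≡ app σ (suc zero) →
        ∃ λ b → ∀ x → swap^ b (restrict σ) x ≡ app σ x
      extend b eq₀ eq₁ = b , λ
        { zero          → eq₀
        ; (suc zero)    → eq₁
        ; (suc (suc i)) → sym (proj₂ (image σ i))
        }
      cases : ∀ x → app σ zero ≡ x → ∀ y → app σ (suc zero) ≡ y → ∃ λ b → ∀ x → swap^ b (restrict σ) x ≡ app σ x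
      cases zero          eq₀ (suc zero)    eq₁ = extend false (sym eq₀) (sym eq₁)
      cases (suc zero)    eq₀ zero          eq₁ = extend true (sym eq₀) (sym eq₁)
      cases zero          eq₀ zero          eq₁ = contradiction (perm-injective (perm σ) (trans eq₀ (sym eq₁))) λ ()
      cases (suc zero)    eq₀ (suc zero)    eq₁ = contradiction (perm-injective (perm σ) (trans eq₀ (sym eq₁))) λ ()
      cases (suc (suc i)) eq₀ _             _   = contradiction eq₀ (isolated-image σ (λ _ ()) i)
      cases _             _   (suc (suc i)) eq₁ = contradiction eq₁ (isolated-image σ (λ _ ()) i)

  extension : ∀ {k} → NoDominating Γ → AutIsoQ8C2 Γ k → AutIsoQ8C2 Γ⁺ (suc k)
  extension {k} noDominating iso = record
    { φ    = φ⁺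
    ; hom  = λ { (q , b ∷ v) (r , c ∷ w) → swap^-∘ b c _ _ _ (iso.hom (q , v) (r , w)) }
    ; inj  = φ⁺-injective
    ; surj = φ⁺-surjective
    }
    where
    module iso = AutIsoQ8C2 iso
    open Restriction noDominating
    φ⁺ : Q8×C2^ (suc k) → Automorphism Γ⁺
    φ⁺ (q , b ∷ v) = lift b (iso.φ (q , v))
    swap^-injective : ∀ b c → swap^ b id zero ≡ swap^ c id zero → b ≡ c
    swap^-injective false false _ = refl
    swap^-injective true  true  _ = refl
    φ⁺-injective : ∀ a b → (∀ x → app (φ⁺ a) x ≡ app (φ⁺ b) x) → a ≡ b
    φ⁺-injective (q , b ∷ v) (r , c ∷ w) eq
      with swap^-injective b c (eq zero)
         | iso.inj (q , v) (r , w) (λ i → Fin.suc-injective (Fin.suc-injective (eq (suc (suc i)))))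
    ... | refl | refl = refl
    swap^-cong : ∀ b {f g : Fin n → Fin n} → (∀ i → f i ≡ g i) → ∀ x → swap^ b f x ≡ swap^ b g x
    swap^-cong false eq zero          = refl
    swap^-cong false eq (suc zero)    = refl
    swap^-cong true  eq zero          = refl
    swap^-cong true  eq (suc zero)    = refl
    swap^-cong b     eq (suc (suc i)) = cong (2 ↑ʳ_) (eq i)
    φ⁺-surjective : ∀ σ → Σ (Q8×C2^ (suc k)) λ a → ∀ x → app (φ⁺ a) x ≡ app σ x
    φ⁺-surjective σ with iso.surj (restriction σ) | lift-restriction σ
    ... | (q , v) , eq | b , eq⁺ = (q , b ∷ v) , λ x → trans (swap^-cong b eq x) (eq⁺ x)

-- Automorphisms by backtracking

module Backtracking {n : ℕ} (Γ : Graph n) {A : Set} (any-A : Exhaustible A) (f : A → Fin n → Fin n) where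

  Compatible : List (Fin n × Fin n) → Fin n → Fin n → Set
  Compatible xs v y = All (λ (u , x) → adj Γ x y ≡ adj Γ u v × (x ≡ y → u ≡ v)) xs

  -- A search tree as a proposition: each compatible way of extending the partial map `xs` over `vs`
  -- ends in a map induced by some `a`. Incompatible images are cut off at once.
  Covered : List (Fin n) → List (Fin n × Fin n) → Set
  Covered []       xs = ∃ λ a → All (λ (u , x) → f a u ≡ x) xs
  Covered (v ∷ vs) xs = ∀ y → Compatible xs v y → Covered vs ((v , y) ∷ xs)

  covered? : ∀ vs xs → Dec (Covered vs xs)
  covered? []       xs = any-A λ a → All.all? (λ (u , x) → f a u Fin.≟ x) xs
  covered? (v ∷ vs) xs = Fin.all? λ y →
    All.all? (λ (u , x) → (adj Γ x y Bool.≟ adj Γ u v) ×-dec ((x Fin.≟ y) →-dec (u Fin.≟ v))) xs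
    →-dec covered? vs ((v , y) ∷ xs)

  -- At each level `σ` selects the branch `y = app σ v`, which is compatible; the leaf so reached
  -- supplies `a`.
  covered-sound : ∀ (σ : Automorphism Γ) vs {xs} → Covered vs xs → All (λ (u , x) → app σ u ≡ x) xs →
    ∃ λ a → All (λ (u , _) → f a u ≡ app σ u) xs × All (λ u → f a u ≡ app σ u) vs
  covered-sound σ [] (a , p) q = a , All.zipWith (λ (r , s) → trans r (sym s)) (p , q) , All.[]
  covered-sound σ (v ∷ vs) covered q
    with covered-sound σ vs (covered (app σ v) (All.map compatible q)) (refl All.∷ q)
    where
    compatible : ∀ {p} → app σ (proj₁ p) ≡ proj₂ p →
      adj Γ (proj₂ p) (app σ v) ≡ adj Γ (proj₁ p) v × (proj₂ p ≡ app σ v → proj₁ p ≡ v)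
    compatible refl = preserve σ _ v , perm-injective (perm σ)
  ... | a , fv All.∷ fxs , fvs = a , fxs , fv All.∷ fvs

-- A graph on two regular orbits of Q₈

Vertex : Set
Vertex = Bool × Q8

exhaust-Vertex : Exhaustible Vertex
exhaust-Vertex = exhaust-× exhaust-Bool exhaust-Q8

bit : Bool → Fin 2
bit false = # 0
bit true  = # 1

encode : Vertex → Fin 16
encode (o , s , u) = combine (bit o) (combine (bit s) (index u))

vertices : Vec Vertex 16
vertices =
  (false , false , 𝟙) ∷ (false , false , 𝕚) ∷ (false , false , 𝕛) ∷ (false , false , 𝕜) ∷
  (false , true  , 𝟙) ∷ (false , true  , 𝕚) ∷ (false , true  , 𝕛) ∷ (false , true  , 𝕜) ∷
  (true  , false , 𝟙) ∷ (true  , false , 𝕚) ∷ (true  , false , 𝕛) ∷ (true  , false , 𝕜) ∷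
  (true  , true  , 𝟙) ∷ (true  , true  , 𝕚) ∷ (true  , true  , 𝕛) ∷ (true  , true  , 𝕜) ∷ []

decode : Fin 16 → Vertex
decode = Vec.lookup vertices

_≟V_ : DecidableEquality Vertex
(o , a) ≟V (p , b) = map′ (λ (p , q) → cong₂ _,_ p q) (λ { refl → refl , refl }) (o Bool.≟ p ×-dec a ≟Q b)

encode-decode : ∀ i → encode (decode i) ≡ i
encode-decode = from-yes (Fin.all? λ i → encode (decode i) Fin.≟ i)

decode-encode : ∀ v → decode (encode v) ≡ v
decode-encode = from-yes (∀-dec exhaust-Vertex λ v → decode (encode v) ≟V v)

-- Vertices x, y of sides o, p are adjacent when connection o p (x⁻¹ y).  The connection sets,
-- {±𝕚}, {-1, ±𝕛} and {1, 𝕚, 𝕛}, were found by computer search.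
cross : Q8 → Bool
cross (_     , 𝕜) = false
cross (true  , _) = false
cross (false , _) = true

connection : Bool → Bool → Q8 → Bool
connection false false (_    , 𝕚) = true
connection true  true  (true , 𝟙) = true
connection true  true  (_    , 𝕛) = true
connection false true  a          = cross a
connection true  false a          = cross (Q-inv a)
connection _     _     _          = false

joined : Vertex → Vertex → Bool
joined (o , a) (p , b) = connection o p (Q-inv a ·Q b)

-- Connection sets within a side are closed under inversion, and the two between the sides are
-- inverse to each other.
joined-sym : ∀ v w → joined v w ≡ joined w v
joined-sym = from-yes (∀-dec exhaust-Vertex λ v → ∀-dec exhaust-Vertex λ w → joined v w Bool.≟ joined w v)

joined-irrefl : ∀ v → joined v v ≡ false
joined-irrefl = from-yes (∀-dec exhaust-Vertex λ v → joined v v Bool.≟ false)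

_·V_ : Q8 → Vertex → Vertex
g ·V (o , a) = o , g ·Q a

joined-· : ∀ g v w → joined (g ·V v) (g ·V w) ≡ joined v w
joined-· g (o , a) (p , b) = cong (connection o p) (left-invariant g a b)
  where
  left-invariant : ∀ g a b → Q-inv (g ·Q a) ·Q (g ·Q b) ≡ Q-inv a ·Q b
  left-invariant = from-yes (∀-dec exhaust-Q8 λ g → ∀-dec exhaust-Q8 λ a → ∀-dec exhaust-Q8 λ b →
    (Q-inv (g ·Q a) ·Q (g ·Q b)) ≟Q (Q-inv a ·Q b))

Γ₀ : Graph 16
Γ₀ = record
  { adj    = λ i j → joined (decode i) (decode j)
  ; sym    = λ i j → joined-sym (decode i) (decode j)
  ; irrefl = λ i → joined-irrefl (decode i)
  }

Γ₀-noDominating : NoDominating Γ₀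
Γ₀-noDominating = from-yes (Fin.all? λ i → Fin.any? λ j → ¬? (j Fin.≟ i) ×-dec (adj Γ₀ i j Bool.≟ false))

infixr 7 _·₀_

_·₀_ : Q8 → Fin 16 → Fin 16
g ·₀ i = encode (g ·V decode i)

·₀-hom : ∀ g h i → (g ·Q h) ·₀ i ≡ g ·₀ h ·₀ i
·₀-hom g h i = cong encode (begin
  (g ·Q h) ·V decode i                   ≡⟨ cong (proj₁ (decode i) ,_) (Q-assoc g h (proj₂ (decode i))) ⟩
  g ·V (h ·V decode i)                   ≡⟨ cong (g ·V_) (decode-encode (h ·V decode i)) ⟨
  g ·V decode (h ·₀ i)                   ∎)
  where open ≡-Reasoning

·₀-unit : ∀ i → (false , 𝟙) ·₀ i ≡ i
·₀-unit i = trans (cong (λ a → encode (proj₁ (decode i) , a)) (Q-unit (proj₂ (decode i)))) (encode-decode i)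

-- Each side is a regular orbit, so the image of one vertex determines the element.
·₀-faithful : ∀ g h → g ·₀ # 0 ≡ h ·₀ # 0 → g ≡ h
·₀-faithful = from-yes (∀-dec exhaust-Q8 λ g → ∀-dec exhaust-Q8 λ h →
  (g ·₀ # 0 Fin.≟ h ·₀ # 0) →-dec (g ≟Q h))

Q8-automorphism : Q8 → Automorphism Γ₀
Q8-automorphism g = record
  { perm     = permutation (g ·₀_) (Q-inv g ·₀_)
      (λ i → trans (sym (·₀-hom g (Q-inv g) i)) (trans (cong (_·₀ i) (Q-inverseʳ g)) (·₀-unit i)))
      (λ i → trans (sym (·₀-hom (Q-inv g) g i)) (trans (cong (_·₀ i) (Q-inverseˡ g)) (·₀-unit i)))
  ; preserve = λ i j → trans
      (cong₂ joined (decode-encode (g ·V decode i)) (decode-encode (g ·V decode j)))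
      (joined-· g (decode i) (decode j))
  }

-- An order of the vertices that keeps the search tree small.
searchOrder : List (Fin 16)
searchOrder = # 8 ∷ # 12 ∷ # 10 ∷ # 14 ∷ # 2 ∷ # 1 ∷ # 7 ∷ # 5 ∷ # 9 ∷ # 4 ∷ # 0 ∷ # 15 ∷ # 13 ∷ # 3 ∷ # 6 ∷ # 11 ∷ []

searchOrder-complete : ∀ i → i ∈ searchOrder
searchOrder-complete = from-yes (Fin.all? λ i → Any.any? (i Fin.≟_) searchOrder)

module Search = Backtracking Γ₀ exhaust-Q8 _·₀_

-- Evaluating the search shows that every automorphism of `Γ₀` is a left translation.
Γ₀-covered : Search.Covered searchOrder []
Γ₀-covered = from-yes (Search.covered? searchOrder [])

Γ₀-Q8 : AutIsoQ8C2 Γ₀ 0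
Γ₀-Q8 = record
  { φ    = λ (g , _) → Q8-automorphism g
  ; hom  = λ (g , _) (h , _) → ·₀-hom g h
  ; inj  = λ { (g , []) (h , []) eq → cong (_, []) (·₀-faithful g h (eq (# 0))) }
  ; surj = λ σ → let g , _ , eq = Search.covered-sound σ searchOrder Γ₀-covered All.[]
                 in (g , []) , λ i → All.lookup eq (searchOrder-complete i)
  }

-- Iterating the extension, and the theorem

order : ℕ → ℕ
order zero    = 16
order (suc k) = 2 + order k

order≡ : ∀ k → order k ≡ 16 + 2 * k
order≡ zero    = refl
order≡ (suc k) = trans (cong (2 +_) (order≡ k)) (sym (cong (16 +_) (*-suc 2 k)))

-- `NoDominating` is carried along as the hypothesis of each `extension`, and `order` unfolds to the
-- vertex count of `Γ⁺`.
realisation : ∀ k → Σ (Graph (order k)) λ Γ → NoDominating Γ × AutIsoQ8C2 Γ k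
realisation zero    = Γ₀ , Γ₀-noDominating , Γ₀-Q8
realisation (suc k) with realisation k
... | Γ , noDominating , iso = Γ⁺ , Γ⁺-noDominating , extension noDominating iso
  where open Extension Γ

upper-bound : ∀ k → Σ (Graph (16 + 2 * k)) λ Γ → AutIsoQ8C2 Γ k
upper-bound k = subst (λ n → Σ (Graph n) λ Γ → AutIsoQ8C2 Γ k) (order≡ k)
  (let Γ , _ , iso = realisation k in Γ , iso)

theorem3 : ∀ (k : ℕ) → 1 ≤ k → αQ8C2≡ k (16 + 2 * k)
theorem3 k _ = upper-bound k , λ n Γ iso → LowerBound.lower-bound iso
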